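{- Let $\mathbf{s}=(s_1,s_2,\ldots)$ be a sequence of positive integers and $n\ge3$. If $s_n\ge s_{n-1}$, then $\mathbf{s}$ is $n$-contractible. Thus, if $\mathbf{s}$ is such that $(s_i)_{i=2}^{\infty}$ is nondecreasing, then $\mathbf{s}$ is contractible. In particular, nondecreasing sequences are contractible.
   Context: For a finite sequence $(s_1,\ldots,s_n)$ of positive integers, let $\mathbf{v}_i=(0,\ldots,0,s_i,s_{i+1},\ldots,s_n)\in\mathbb{R}^n$ (first $i-1$ coordinates zero) for $1\le i\le n$, and let $\Pi_n^{(\mathbf{s})}=\left\{\sum_{i=1}^n\alpha_i\mathbf{v}_i \mid 0\le\alpha_i<1\right\}$. Define $Q_n^{(\mathbf{s})}(x)=\sum_{\lambda\in\Pi_n^{(\mathbf{s})}\cap\mathbb{Z}^n}x^{\lambda_n}$. For an infinite sequence $\mathbf{s}$ of positive integers, $Q_n^{(\mathbf{s})}$ means $Q_n^{(s_1,\ldots,s_n)}$. For $n\ge 2$ put $$P_{n-1}^{(\mathbf{s})}(x)=\frac{Q_n^{(\mathbf{s})}(x)}{1+x+\cdots+x^{s_n-1}},$$ which is a polynomial. In this statement the coefficient sequence of a polynomial is the sequence of its nonzero coefficients, listed in order of exponent. For $n\ge 3$, $\mathbf{s}$ is $n$-contractible if the coefficient sequences of $Q_{n-1}^{(\mathbf{s})}(x)$ and $P_{n-1}^{(\mathbf{s})}(x)$ coincide. $\mathbf{s}$ is contractible if it is $n$-contractible for all $n\ge 3$. -}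

module Defs where

open import Data.Bool.Base using (if_then_else_)
open import Data.Nat.Base as ℕ using (ℕ; zero; suc)
open import Data.Integer.Base as ℤ using (ℤ; +_; 0ℤ; 1ℤ; ∣_∣)
import Data.Integer.Properties as ℤP
import Data.Integer.Tactic.RingSolver as ℤRing
open import Data.Rational.Base as ℚ using (ℚ; 0ℚ; 1ℚ; _/_; toℚᵘ)
import Data.Rational.Properties as ℚP
import Data.Rational.Unnormalised.Base as ℚᵘ
import Data.Rational.Unnormalised.Properties as ℚᵘP
open import Data.Fin.Base using (Fin; zero; suc; toℕ; inject₁)
open import Data.Fin.Properties using (_≤?_; all?)
open import Data.List.Base as List
  using (List; []; _∷_; [_]; foldr; filter; replicate; upTo; cartesianProductWith)
open import Data.List.Membership.Propositional using (_∈_)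
open import Data.List.Membership.Propositional.Properties
  using (∈-cartesianProductWith⁺; ∈-filter⁺; ∈-filter⁻; ∈-map⁺; ∈-upTo⁺)
open import Data.List.Relation.Unary.Any using (here)
open import Data.List.Relation.Unary.All using ([])
open import Data.List.Relation.Unary.AllPairs using ([]; _∷_)
open import Data.List.Relation.Unary.Unique.Propositional using (Unique)
import Data.List.Relation.Unary.Unique.Propositional.Properties as Unique
open import Data.Vec.Base as Vec using (Vec; []; _∷_; lookup)
open import Data.Vec.Properties using (∷-injective)
open import Data.Vec.Functional using (Vector)
open import Data.Product.Base using (_×_; _,_; ∃-syntax; Σ-syntax; proj₁; proj₂)
open import Function.Base using (_∘_)
open import Function.Bundles using (_⇔_; mk⇔; Equivalence)
open import Relation.Nullary using (Dec; yes; no; does; ¬?; _×-dec_)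
open import Relation.Binary.PropositionalEquality hiding ([_])
open import Algebra.Bundles using (CommutativeRing)
open import Algebra.Properties.Monoid.Sum
  (CommutativeRing.+-monoid ℚP.+-*-commutativeRing)
  using (sum; sum-cong-≗; sum-replicate-zero)

record ℕ⁺ : Set where
  constructor mkℕ⁺
  field
    value : ℕ
    {{nonZero}} : ℕ.NonZero value

open ℕ⁺ public using (value)

private variable
  n : ℕ

------------------------------------------------------------------------
-- The half-open parallelepiped Π

-- 𝐯 s i j is the j-th coordinate of 𝐯ᵢ.  Here, and only for finite sequences,
-- indices start at 0.
𝐯 : Vector ℕ⁺ n → Fin n → Fin n → ℤ
𝐯 s i j = if does (i ≤? j) then + value (s j) else 0ℤ

-- The integer points of Π.  The 𝐯ᵢ are integral and linearly independent, so
-- the real coefficients αᵢ of an integer vector are automatically rational.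
_∈Π_ : Vec ℤ n → Vector ℕ⁺ n → Set
_∈Π_ {n} pt s = Σ[ α ∈ Vector ℚ n ]
    (∀ (i : Fin n) → 0ℚ ℚ.≤ α i × α i ℚ.< 1ℚ)
  × (∀ (j : Fin n) → lookup pt j / 1 ≡ sum (λ i → α i ℚ.* (𝐯 s i j / 1)))

------------------------------------------------------------------------
-- Π ∩ ℤⁿ is finite: the list `latticePoints s` enumerates it
-- (see `∈-latticePoints` and `latticePoints-unique`).

/1≃ : ∀ z → toℚᵘ (z / 1) ℚᵘ.≃ ℚᵘ.mkℚᵘ z 0
/1≃ z = ℚP.toℚᵘ-fromℚᵘ (ℚᵘ.mkℚᵘ z 0)

/1-+ : ∀ x y → x / 1 ℚ.+ y / 1 ≡ (x ℤ.+ y) / 1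
/1-+ x y = ℚP.toℚᵘ-injective (ℚᵘP.≃-trans (ℚP.toℚᵘ-homo-+ (x / 1) (y / 1))
  (ℚᵘP.≃-trans (ℚᵘP.+-cong (/1≃ x) (/1≃ y))
  (ℚᵘP.≃-trans (ℚᵘ.*≡* (lemma x y)) (ℚᵘP.≃-sym (/1≃ (x ℤ.+ y))))))
  where
  lemma : ∀ a b → (a ℤ.* 1ℤ ℤ.+ b ℤ.* 1ℤ) ℤ.* 1ℤ ≡ (a ℤ.+ b) ℤ.* 1ℤ
  lemma = ℤRing.solve-∀

/1-* : ∀ x y → x / 1 ℚ.* (y / 1) ≡ (x ℤ.* y) / 1
/1-* x y = ℚP.toℚᵘ-injective (ℚᵘP.≃-trans (ℚP.toℚᵘ-homo-* (x / 1) (y / 1))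
  (ℚᵘP.≃-trans (ℚᵘP.*-cong (/1≃ x) (/1≃ y)) (ℚᵘP.≃-sym (/1≃ (x ℤ.* y)))))

/-*-cancel : ∀ z c .{{_ : ℕ.NonZero c}} → (z / c) ℚ.* (+ c / 1) ≡ z / 1
/-*-cancel z c@(suc d) = ℚP.toℚᵘ-injective
  (ℚᵘP.≃-trans (ℚP.toℚᵘ-homo-* (z / c) (+ c / 1))
  (ℚᵘP.≃-trans (ℚᵘP.*-cong (ℚP.toℚᵘ-fromℚᵘ (ℚᵘ.mkℚᵘ z d)) (/1≃ (+ c)))
  (ℚᵘP.≃-trans (ℚᵘ.*≡* eq) (ℚᵘP.≃-sym (/1≃ z)))))
  where
  eq : (z ℤ.* + c) ℤ.* 1ℤ ≡ z ℤ.* + suc (d ℕ.* 1)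
  eq = trans (ℤP.*-identityʳ _)
    (cong (λ k → z ℤ.* + suc k) (sym (ℕ*1 d)))
    where
    open import Data.Nat.Properties renaming (*-identityʳ to ℕ*1)

/1-cancel-≤ : ∀ {x y} → x / 1 ℚ.≤ y / 1 → x ℤ.≤ y
/1-cancel-≤ {x} {y} p
  with ℚᵘP.≤-respʳ-≃ (/1≃ y) (ℚᵘP.≤-respˡ-≃ (/1≃ x) (ℚP.toℚᵘ-mono-≤ p))
... | ℚᵘ.*≤* q = subst₂ ℤ._≤_ (ℤP.*-identityʳ x) (ℤP.*-identityʳ y) q

/1-nonNeg : ∀ m → ℚ.NonNegative (+ m / 1)
/1-nonNeg m = ℚP.normalize-nonNeg m 1

/1-pos : ∀ m .{{_ : ℕ.NonZero m}} → ℚ.Positive (+ m / 1)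
/1-pos m = ℚP.normalize-pos m 1

*-cancelʳ : ∀ r .{{_ : ℚ.Positive r}} {p q} → p ℚ.* r ≡ q ℚ.* r → p ≡ q
*-cancelʳ r eq = ℚP.≤-antisym
  (ℚP.*-cancelʳ-≤-pos r (ℚP.≤-reflexive eq))
  (ℚP.*-cancelʳ-≤-pos r (ℚP.≤-reflexive (sym eq)))

-- α₀ + ⋯ + αⱼ
partialSum : Vector ℚ n → Fin n → ℚ
partialSum α zero    = α zero
partialSum α (suc j) = α zero ℚ.+ partialSum (α ∘ suc) j

<ᵇ-suc : ∀ m k → (m ℕ.<ᵇ suc k) ≡ (m ℕ.≤ᵇ k)
<ᵇ-suc zero    k = refl
<ᵇ-suc (suc m) k = refl

combination : ∀ (α : Vector ℚ n) j (c : ℤ) →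
  sum (λ i → α i ℚ.* ((if does (i ≤? j) then c else 0ℤ) / 1))
    ≡ partialSum α j ℚ.* (c / 1)
combination {suc n} α zero c = trans
  (cong (α zero ℚ.* (c / 1) ℚ.+_)
    (trans (sum-cong-≗ {n} (λ i → ℚP.*-zeroʳ (α (suc i))))
           (sum-replicate-zero n)))
  (ℚP.+-identityʳ _)
combination {suc n} α (suc j) c = trans
  (cong (α zero ℚ.* (c / 1) ℚ.+_) (trans
    (sum-cong-≗ {n} (λ i → cong
      (λ b → α (suc i) ℚ.* ((if b then c else 0ℤ) / 1)) (<ᵇ-suc (toℕ i) (toℕ j))))
    (combination (α ∘ suc) j c)))
  (sym (ℚP.*-distribʳ-+ (c / 1) (α zero) _))

differences : Vector ℚ n → Vector ℚ n
differences r zero    = r zero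
differences r (suc j) = r (suc j) ℚ.- r (inject₁ j)

partialSum-step : ∀ (α : Vector ℚ (suc n)) j →
  partialSum α (suc j) ≡ partialSum α (inject₁ j) ℚ.+ α (suc j)
partialSum-step α zero    = refl
partialSum-step α (suc j) = trans
  (cong (α zero ℚ.+_) (partialSum-step (α ∘ suc) j))
  (sym (ℚP.+-assoc (α zero) _ _))

differences-partialSum : ∀ (α : Vector ℚ n) j → differences (partialSum α) j ≡ α j
differences-partialSum α zero    = refl
differences-partialSum α (suc j) = begin
  partialSum α (suc j) ℚ.- p        ≡⟨ cong (ℚ._- p) (partialSum-step α j) ⟩
  (p ℚ.+ α (suc j)) ℚ.- p           ≡⟨ cong (ℚ._- p) (ℚP.+-comm p (α (suc j))) ⟩
  (α (suc j) ℚ.+ p) ℚ.- p           ≡⟨ ℚP.+-assoc (α (suc j)) p (ℚ.- p) ⟩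
  α (suc j) ℚ.+ (p ℚ.- p)           ≡⟨ cong (α (suc j) ℚ.+_) (ℚP.+-inverseʳ p) ⟩
  α (suc j) ℚ.+ 0ℚ                  ≡⟨ ℚP.+-identityʳ _ ⟩
  α (suc j)                         ∎
  where
  open ≡-Reasoning
  p = partialSum α (inject₁ j)

differences-cong : ∀ {r r′ : Vector ℚ n} → r ≗ r′ → differences r ≗ differences r′
differences-cong eq zero    = eq zero
differences-cong eq (suc j) = cong₂ ℚ._-_ (eq (suc j)) (eq (inject₁ j))

ratio : Vec ℤ n → Vector ℕ⁺ n → Vector ℚ n
ratio pt s j = _/_ (lookup pt j) (value (s j)) {{ℕ⁺.nonZero (s j)}}

partialSum-ratio : ∀ (pt : Vec ℤ n) s α →
  (∀ j → lookup pt j / 1 ≡ sum (λ i → α i ℚ.* (𝐯 s i j / 1))) →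
  partialSum α ≗ ratio pt s
partialSum-ratio pt s α eq j with s j in sj
... | mkℕ⁺ c {{c≢0}} = *-cancelʳ (+ c / 1) {{/1-pos c {{c≢0}}}} (begin
  partialSum α j ℚ.* (+ c / 1)                 ≡⟨ cong (λ d → partialSum α j ℚ.* (+ value d / 1)) sj ⟨
  partialSum α j ℚ.* (+ value (s j) / 1)       ≡⟨ combination α j (+ value (s j)) ⟨
  sum (λ i → α i ℚ.* (𝐯 s i j / 1))            ≡⟨ eq j ⟨
  lookup pt j / 1                              ≡⟨ /-*-cancel (lookup pt j) c {{c≢0}} ⟨
  _/_ (lookup pt j) c {{c≢0}} ℚ.* (+ c / 1)    ∎)
  where open ≡-Reasoning

coefficients-unique : ∀ (pt : Vec ℤ n) s → ((α , _) : pt ∈Π s) →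
  α ≗ differences (ratio pt s)
coefficients-unique pt s (α , _ , eq) i = trans
  (sym (differences-partialSum α i))
  (differences-cong (partialSum-ratio pt s α eq) i)

_∈Π?_ : (pt : Vec ℤ n) (s : Vector ℕ⁺ n) → Dec (pt ∈Π s)
_∈Π?_ {n} pt s
  with all? (λ i → (0ℚ ℚP.≤? β i) ×-dec (β i ℚP.<? 1ℚ))
     | all? (λ j → lookup pt j / 1 ℚP.≟ sum (λ i → β i ℚ.* (𝐯 s i j / 1)))
  where
  β : Vector ℚ n
  β = differences (ratio pt s)
... | yes p | yes q = yes (_ , p , q)
... | no ¬p | _     = no λ m@(α , b , _) → ¬p λ i →
  subst (λ x → 0ℚ ℚ.≤ x × x ℚ.< 1ℚ) (coefficients-unique pt s m i) (b i)
... | _     | no ¬q = no λ m@(α , _ , e) → ¬q λ j →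
  trans (e j) (sum-cong-≗ {n} λ i →
    cong (ℚ._* (𝐯 s i j / 1)) (coefficients-unique pt s m i))

partialSum-bounds : ∀ (α : Vector ℚ n) →
  (∀ i → 0ℚ ℚ.≤ α i × α i ℚ.< 1ℚ) →
  ∀ j → 0ℚ ℚ.≤ partialSum α j × partialSum α j ℚ.≤ + n / 1
partialSum-bounds {suc n} α b zero =
  proj₁ (b zero) ,
  (begin
    α zero               ≤⟨ ℚP.<⇒≤ (proj₂ (b zero)) ⟩
    1ℚ                   ≡⟨ ℚP.+-identityʳ 1ℚ ⟨
    1ℚ ℚ.+ 0ℚ            ≤⟨ ℚP.+-monoʳ-≤ 1ℚ (ℚP.nonNegative⁻¹ (+ n / 1) {{/1-nonNeg n}}) ⟩
    1ℚ ℚ.+ + n / 1       ≡⟨ /1-+ 1ℤ (+ n) ⟩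
    + suc n / 1          ∎)
  where open ℚP.≤-Reasoning
partialSum-bounds {suc n} α b (suc j)
  with l , u ← partialSum-bounds (α ∘ suc) (b ∘ suc) j =
  ℚP.+-mono-≤ (proj₁ (b zero)) l ,
  ℚP.≤-trans (ℚP.+-mono-≤ (ℚP.<⇒≤ (proj₂ (b zero))) u)
             (ℚP.≤-reflexive (/1-+ 1ℤ (+ n)))

coordinate-bounds : ∀ (pt : Vec ℤ n) s → pt ∈Π s →
  ∀ j → 0ℤ ℤ.≤ lookup pt j × lookup pt j ℤ.≤ + n ℤ.* + value (s j)
coordinate-bounds {n} pt s (α , b , e) j
  with l , u ← partialSum-bounds α b j =
  /1-cancel-≤ (begin
    0ℚ                       ≡⟨ ℚP.*-zeroˡ c ⟨
    0ℚ ℚ.* c                 ≤⟨ ℚP.*-monoʳ-≤-nonNeg c {{c≥0}} l ⟩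
    partialSum α j ℚ.* c     ≡⟨ eq ⟨
    lookup pt j / 1          ∎) ,
  /1-cancel-≤ (begin
    lookup pt j / 1          ≡⟨ eq ⟩
    partialSum α j ℚ.* c     ≤⟨ ℚP.*-monoʳ-≤-nonNeg c {{c≥0}} u ⟩
    (+ n / 1) ℚ.* c          ≡⟨ /1-* (+ n) (+ value (s j)) ⟩
    (+ n ℤ.* + value (s j)) / 1 ∎)
  where
  open ℚP.≤-Reasoning
  c = + value (s j) / 1
  c≥0 : ℚ.NonNegative c
  c≥0 = /1-nonNeg (value (s j))
  eq : lookup pt j / 1 ≡ partialSum α j ℚ.* c
  eq = trans (e j) (combination α j (+ value (s j)))

-- All integer vectors with coordinates 0 ≤ λⱼ ≤ bⱼ.
box : Vector ℕ n → List (Vec ℤ n)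
box {zero}  b = [ [] ]
box {suc n} b =
  cartesianProductWith _∷_ (List.map +_ (upTo (suc (b zero)))) (box (b ∘ suc))

latticePoints : Vector ℕ⁺ n → List (Vec ℤ n)
latticePoints {n} s = filter (_∈Π? s) (box (λ j → n ℕ.* value (s j)))

∈-box : ∀ (b : Vector ℕ n) pt →
  (∀ j → 0ℤ ℤ.≤ lookup pt j × lookup pt j ℤ.≤ + b j) → pt ∈ box b
∈-box {zero}  b []       h = here refl
∈-box {suc n} b (x ∷ pt) h = ∈-cartesianProductWith⁺ _∷_
  (coordinate x (h zero)) (∈-box (b ∘ suc) pt (h ∘ suc))
  where
  coordinate : ∀ x → 0ℤ ℤ.≤ x × x ℤ.≤ + b zero →
    x ∈ List.map +_ (upTo (suc (b zero)))
  coordinate (+ k) (_ , ℤ.+≤+ k≤b) = ∈-map⁺ +_ (∈-upTo⁺ (ℕ.s≤s k≤b))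

box-unique : ∀ (b : Vector ℕ n) → Unique (box b)
box-unique {zero}  b = [] ∷ []
box-unique {suc n} b = Unique.cartesianProductWith⁺ _∷_ ∷-injective
  (Unique.map⁺ ℤP.+-injective (Unique.upTo⁺ (suc (b zero)))) (box-unique (b ∘ suc))

∈-latticePoints : ∀ (s : Vector ℕ⁺ n) pt → pt ∈ latticePoints s ⇔ pt ∈Π s
∈-latticePoints {n} s pt = mk⇔
  (proj₂ ∘ ∈-filter⁻ (_∈Π? s) {xs = box (λ j → n ℕ.* value (s j))})
  (λ m → ∈-filter⁺ (_∈Π? s)
    (∈-box _ pt λ j → let l , u = coordinate-bounds pt s m j in
      l , subst (lookup pt j ℤ.≤_) (sym (ℤP.pos-* n (value (s j)))) u)
    m)

latticePoints-unique : ∀ (s : Vector ℕ⁺ n) → Unique (latticePoints s)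
latticePoints-unique {n} s =
  Unique.filter⁺ (_∈Π? s) (box-unique (λ j → n ℕ.* value (s j)))

latticePoints-nonNeg : ∀ (s : Vector ℕ⁺ n) pt → pt ∈ latticePoints s →
  ∀ j → 0ℤ ℤ.≤ lookup pt j
latticePoints-nonNeg s pt m =
  proj₁ ∘ coordinate-bounds pt s (Equivalence.to (∈-latticePoints s pt) m)

------------------------------------------------------------------------
-- Polynomials over ℤ: lists of coefficients, constant term first, considered
-- up to trailing zeros.

Poly : Set
Poly = List ℤ

coeff : Poly → ℕ → ℤ
coeff []      k       = 0ℤ
coeff (a ∷ p) zero    = a
coeff (a ∷ p) (suc k) = coeff p k

infix 4 _≈ₚ_
_≈ₚ_ : Poly → Poly → Set
p ≈ₚ q = ∀ k → coeff p k ≡ coeff q k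

infixl 6 _+ₚ_
_+ₚ_ : Poly → Poly → Poly
[]      +ₚ q       = q
(a ∷ p) +ₚ []      = a ∷ p
(a ∷ p) +ₚ (b ∷ q) = a ℤ.+ b ∷ p +ₚ q

infixl 7 _*ₚ_
_*ₚ_ : Poly → Poly → Poly
[]      *ₚ q = []
(a ∷ p) *ₚ q = List.map (a ℤ.*_) q +ₚ (0ℤ ∷ p *ₚ q)

x^ : ℕ → Poly
x^ zero    = [ 1ℤ ]
x^ (suc k) = 0ℤ ∷ x^ k

Σₚ : List Poly → Poly
Σₚ = foldr _+ₚ_ []

-- 1 + x + ⋯ + x^(m-1)
geometric : ℕ → Poly
geometric m = Σₚ (List.map x^ (upTo m))

nonzeroCoeffs : Poly → List ℤ
nonzeroCoeffs = filter (λ c → ¬? (c ℤP.≟ 0ℤ))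

------------------------------------------------------------------------
-- Contractibility.  An infinite sequence s₁, s₂, … is a function s : ℕ → ℕ⁺
-- whose value at 0 is never used.

-- The last coordinate (0 for the vector of length 0, which is not needed).
lastCoord : Vec ℤ n → ℤ
lastCoord {zero}  pt = 0ℤ
lastCoord {suc n} pt = Vec.last pt

prefix : (ℕ → ℕ⁺) → ∀ n → Vector ℕ⁺ n
prefix s n i = s (suc (toℕ i))

-- Taking absolute values is harmless here, by `latticePoints-nonNeg`.
Q : (ℕ → ℕ⁺) → ℕ → Poly
Q s n = Σₚ (List.map (λ pt → x^ ∣ lastCoord pt ∣) (latticePoints (prefix s n)))

-- p is P_{n-1}, the quotient of Qₙ by 1 + x + ⋯ + x^(sₙ-1); such a p is unique
-- up to ≈ₚ because the divisor is monic.
IsQuotient : (ℕ → ℕ⁺) → ℕ → Poly → Set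
IsQuotient s n p = p *ₚ geometric (value (s n)) ≈ₚ Q s n

-- Meaningful for n ≥ 3.
ContractibleAt : (ℕ → ℕ⁺) → ℕ → Set
ContractibleAt s n = ∃[ p ]
  IsQuotient s n p × nonzeroCoeffs (Q s (n ℕ.∸ 1)) ≡ nonzeroCoeffs p

Contractible : (ℕ → ℕ⁺) → Set
Contractible s = ∀ n → 3 ℕ.≤ n → ContractibleAt s n

NondecreasingFrom : ℕ → (ℕ → ℕ⁺) → Set
NondecreasingFrom k s = ∀ i j → k ℕ.≤ i → i ℕ.≤ j → value (s i) ℕ.≤ value (s j)

{-# OPTIONS --safe #-}

-- The first n-1 coordinates of a point of Πₙ form a point of Πₙ₋₁, and over a
-- point of Πₙ₋₁ with last coordinate k the possible last coordinates are the
-- sₙ consecutive integers starting at f(k) = ⌈k sₙ / sₙ₋₁⌉.  Hence Pₙ₋₁ arises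
-- from Qₙ₋₁ by replacing each x^k by x^f(k), and if sₙ ≥ sₙ₋₁ then f is strictly
-- increasing, so that only zero coefficients are inserted.

module Submission where

open import Data.Nat.Base using (ℕ; _≤_; _∸_)
open import Data.Product.Base using (_×_)
open import Defs

open import Data.Nat.Base as ℕ using (zero; suc; pred; _<_; z≤n; s≤s; s≤s⁻¹; NonZero)
import Data.Nat.Properties as ℕP
import Data.Nat.DivMod as ℕD
open import Data.Nat.Divisibility using (n∣m*n)
open import Data.Integer.Base as ℤ using (ℤ; +_; 0ℤ; 1ℤ; ∣_∣)
import Data.Integer.Properties as ℤP
open import Data.Rational.Base as ℚ using (ℚ; 0ℚ; 1ℚ; _/_)
import Data.Rational.Properties as ℚP
import Data.Rational.Unnormalised.Base as ℚᵘ
import Data.Rational.Unnormalised.Properties as ℚᵘP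
open import Data.Fin.Base using (zero; suc; fromℕ; inject₁)
open import Data.Fin.Properties using (toℕ-fromℕ; toℕ-inject₁)
open import Data.Fin.Induction using (<-weakInduction)
open import Data.Fin.Relation.Unary.Top using (view; ‵fromℕ; ‵inject₁)
open import Data.List.Base
  using (List; []; _∷_; _++_; map; replicate; upTo; cartesianProductWith)
open import Data.List.Properties using (map-++; map-∘; map-cong; map-id)
open import Data.List.Membership.Propositional using (_∈_)
open import Data.List.Membership.Propositional.Properties
  using (∈-cartesianProductWith⁺; ∈-cartesianProductWith⁻; ∈-upTo⁺; ∈-upTo⁻)
open import Data.List.Membership.Propositional.Properties.WithK using (unique∧set⇒bag)
open import Data.List.Relation.Binary.BagAndSetEquality using (∼bag⇒↭)
open import Data.List.Relation.Binary.Permutation.Propositional as Perm using (_↭_)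
open import Data.List.Relation.Binary.Permutation.Propositional.Properties using (map⁺)
import Data.List.Relation.Unary.Unique.Propositional.Properties as Unique
open import Data.Vec.Base using (Vec; []; _∷_; _∷ʳ_; lookup; last; initLast)
open import Data.Vec.Properties using (∷ʳ-injective; last-∷ʳ)
open import Data.Vec.Functional using (Vector)
open import Data.Product.Base using (_,_; proj₁; proj₂)
open import Function.Base using (_∘_)
open import Function.Bundles using (_⇔_; mk⇔; Equivalence)
open import Relation.Nullary using (yes; no)
open import Relation.Binary.PropositionalEquality

private variable
  m n : ℕ
  A B C D : Set

-- Ceilings

⌈_/_⌉ : ∀ n a .{{_ : NonZero a}} → ℕ
⌈ n / a ⌉ = (n ℕ.+ pred a) ℕ./ a

-- The Galois connection that characterises the ceiling. If `m*a < n`, then `n + (a - 1)` is at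
-- least `(m + 1)*a`, so the quotient exceeds `m`; if `n ≤ m*a`, then `n + (a - 1)` stays below
-- `(m + 1)*a`.
⌈n/a⌉≤m⇔n≤m*a : ∀ n a m .{{_ : NonZero a}} → ⌈ n / a ⌉ ≤ m ⇔ n ≤ m ℕ.* a
⌈n/a⌉≤m⇔n≤m*a n a@(suc a-1) m = mk⇔
  (λ c≤m → ℕP.≮⇒≥ λ m*a<n → ℕP.<⇒≱
    (begin
      suc m                     ≡⟨ ℕD.m*n/n≡m (suc m) a ⟨
      (suc m ℕ.* a) ℕ./ a       ≡⟨ cong (ℕ._/ a) (ℕP.+-comm a (m ℕ.* a)) ⟩
      (m ℕ.* a ℕ.+ a) ℕ./ a     ≡⟨ cong (ℕ._/ a) (ℕP.+-suc (m ℕ.* a) a-1) ⟩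
      suc (m ℕ.* a ℕ.+ a-1) ℕ./ a ≤⟨ ℕD./-monoˡ-≤ a (ℕP.+-monoˡ-≤ a-1 m*a<n) ⟩
      ⌈ n / a ⌉                 ∎)
    c≤m)
  -- `suc m ℕ.* a` reduces to `suc (a-1 ℕ.+ m ℕ.* a)`, so the strict bound on the numerator is a
  -- weak one under `s≤s`.
  (λ n≤m*a → s≤s⁻¹ (ℕD.m<n*o⇒m/o<n {n = suc m} (s≤s
    (subst (n ℕ.+ a-1 ≤_) (ℕP.+-comm (m ℕ.* a) a-1) (ℕP.+-monoˡ-≤ a-1 n≤m*a)))))
  where open ℕP.≤-Reasoning

⌈n+m*a/a⌉≡⌈n/a⌉+m : ∀ n m a .{{_ : NonZero a}} → ⌈ n ℕ.+ m ℕ.* a / a ⌉ ≡ ⌈ n / a ⌉ ℕ.+ m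
⌈n+m*a/a⌉≡⌈n/a⌉+m n m a = begin
  (n ℕ.+ m ℕ.* a ℕ.+ pred a) ℕ./ a         ≡⟨ cong (ℕ._/ a) (xy∙z≈xz∙y n (m ℕ.* a) (pred a)) ⟩
  (n ℕ.+ pred a ℕ.+ m ℕ.* a) ℕ./ a         ≡⟨ ℕD.+-distrib-/-∣ʳ (n ℕ.+ pred a) (n∣m*n m) ⟩
  ⌈ n / a ⌉ ℕ.+ (m ℕ.* a) ℕ./ a            ≡⟨ cong (⌈ n / a ⌉ ℕ.+_) (ℕD.m*n/n≡m m a) ⟩
  ⌈ n / a ⌉ ℕ.+ m                          ∎
  where
  open ≡-Reasoning
  open import Algebra.Properties.CommutativeSemigroup ℕP.+-commutativeSemigroup using (xy∙z≈xz∙y)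

-- Raising `k` by one adds `b ≥ a` to the numerator, hence at least one to the ceiling. This is
-- where the assumption that the sequence does not decrease at the last step enters.
⌈k*b/a⌉-mono-< : ∀ {a b} .{{_ : NonZero a}} → a ≤ b →
  ∀ {k l} → k < l → ⌈ k ℕ.* b / a ⌉ < ⌈ l ℕ.* b / a ⌉
⌈k*b/a⌉-mono-< {a} {b} a≤b {k} {l} k<l = begin-strict
  ⌈ k ℕ.* b / a ⌉                 <⟨ ℕP.n<1+n _ ⟩
  suc ⌈ k ℕ.* b / a ⌉             ≡⟨ ℕP.+-comm 1 _ ⟩
  ⌈ k ℕ.* b / a ⌉ ℕ.+ 1           ≡⟨ ⌈n+m*a/a⌉≡⌈n/a⌉+m (k ℕ.* b) 1 a ⟨
  ⌈ k ℕ.* b ℕ.+ 1 ℕ.* a / a ⌉     ≤⟨ ℕD./-monoˡ-≤ a (ℕP.+-monoˡ-≤ (pred a) k*b+a≤l*b) ⟩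
  ⌈ l ℕ.* b / a ⌉                 ∎
  where
  open ℕP.≤-Reasoning
  k*b+a≤l*b : k ℕ.* b ℕ.+ 1 ℕ.* a ≤ l ℕ.* b
  k*b+a≤l*b = begin
    k ℕ.* b ℕ.+ 1 ℕ.* a     ≡⟨ cong (k ℕ.* b ℕ.+_) (ℕP.*-identityˡ a) ⟩
    k ℕ.* b ℕ.+ a           ≤⟨ ℕP.+-monoʳ-≤ (k ℕ.* b) a≤b ⟩
    k ℕ.* b ℕ.+ b           ≡⟨ ℕP.+-comm (k ℕ.* b) b ⟩
    suc k ℕ.* b             ≤⟨ ℕP.*-monoˡ-≤ b k<l ⟩
    l ℕ.* b                 ∎

-- Rational inequalities

p-q+q≡p : ∀ p q → p ℚ.- q ℚ.+ q ≡ p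
p-q+q≡p p q = begin
  p ℚ.- q ℚ.+ q           ≡⟨ ℚP.+-assoc p (ℚ.- q) q ⟩
  p ℚ.+ (ℚ.- q ℚ.+ q)     ≡⟨ cong (p ℚ.+_) (ℚP.+-inverseˡ q) ⟩
  p ℚ.+ 0ℚ                ≡⟨ ℚP.+-identityʳ p ⟩
  p                       ∎
  where open ≡-Reasoning

p+q-q≡p : ∀ p q → p ℚ.+ q ℚ.- q ≡ p
p+q-q≡p p q = begin
  p ℚ.+ q ℚ.- q           ≡⟨ ℚP.+-assoc p q (ℚ.- q) ⟩
  p ℚ.+ (q ℚ.- q)         ≡⟨ cong (p ℚ.+_) (ℚP.+-inverseʳ q) ⟩
  p ℚ.+ 0ℚ                ≡⟨ ℚP.+-identityʳ p ⟩
  p                       ∎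
  where open ≡-Reasoning

p≤q-r⇔p+r≤q : ∀ p q r → p ℚ.≤ q ℚ.- r ⇔ p ℚ.+ r ℚ.≤ q
p≤q-r⇔p+r≤q p q r = mk⇔
  (subst (p ℚ.+ r ℚ.≤_) (p-q+q≡p q r) ∘ ℚP.+-monoˡ-≤ r)
  (subst (ℚ._≤ q ℚ.- r) (p+q-q≡p p r) ∘ ℚP.+-monoˡ-≤ (ℚ.- r))

-- `_/_` reduces to lowest terms, so the comparison is moved to unnormalised fractions, where the
-- order is cross-multiplication by definition.
/-≤-/ : ∀ k a m b .{{_ : NonZero a}} .{{_ : NonZero b}} →
  + k / a ℚ.≤ + m / b ⇔ k ℕ.* b ≤ m ℕ.* a
/-≤-/ k a@(suc a-1) m b@(suc b-1) = mk⇔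
  (λ p≤q → from-ᵘ (ℚᵘP.≤-respʳ-≃ (ℚP.toℚᵘ-fromℚᵘ q) (ℚᵘP.≤-respˡ-≃ (ℚP.toℚᵘ-fromℚᵘ p)
    (ℚP.toℚᵘ-mono-≤ p≤q))))
  (λ kb≤ma → ℚP.toℚᵘ-cancel-≤ (ℚᵘP.≤-respʳ-≃ (ℚᵘP.≃-sym (ℚP.toℚᵘ-fromℚᵘ q))
    (ℚᵘP.≤-respˡ-≃ (ℚᵘP.≃-sym (ℚP.toℚᵘ-fromℚᵘ p))
      (ℚᵘ.*≤* (subst₂ ℤ._≤_ (ℤP.pos-* k b) (ℤP.pos-* m a) (ℤ.+≤+ kb≤ma))))))
  where
  p = ℚᵘ.mkℚᵘ (+ k) a-1
  q = ℚᵘ.mkℚᵘ (+ m) b-1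
  from-ᵘ : p ℚᵘ.≤ q → k ℕ.* b ≤ m ℕ.* a
  from-ᵘ (ℚᵘ.*≤* le) = ℤP.drop‿+≤+ (subst₂ ℤ._≤_ (sym (ℤP.pos-* k b)) (sym (ℤP.pos-* m a)) le)

1+k/a≡[k+a]/a : ∀ k a .{{_ : NonZero a}} → 1ℚ ℚ.+ + k / a ≡ + (k ℕ.+ a) / a
1+k/a≡[k+a]/a k a = *-cancelʳ (+ a / 1) {{/1-pos a}} (begin
  (1ℚ ℚ.+ + k / a) ℚ.* (+ a / 1)
    ≡⟨ ℚP.*-distribʳ-+ (+ a / 1) 1ℚ (+ k / a) ⟩
  1ℚ ℚ.* (+ a / 1) ℚ.+ (+ k / a) ℚ.* (+ a / 1)
    ≡⟨ cong₂ ℚ._+_ (ℚP.*-identityˡ (+ a / 1)) (/-*-cancel (+ k) a) ⟩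
  (+ a / 1) ℚ.+ (+ k / 1)
    ≡⟨ /1-+ (+ a) (+ k) ⟩
  + (a ℕ.+ k) / 1
    ≡⟨ cong (λ z → + z / 1) (ℕP.+-comm a k) ⟩
  + (k ℕ.+ a) / 1
    ≡⟨ /-*-cancel (+ (k ℕ.+ a)) a ⟨
  (+ (k ℕ.+ a) / a) ℚ.* (+ a / 1) ∎)
  where open ≡-Reasoning

InUnitInterval : ℚ → Set
InUnitInterval x = 0ℚ ℚ.≤ x × x ℚ.< 1ℚ

-- Cross-multiplying turns nonnegativity of the difference into `k*b ≤ m*a`, which the Galois
-- connection converts into the lower bound. The upper bound is the negation of the same argument
-- with `k + a` in place of `k`, since adding 1 to `k/a` shifts the ceiling by exactly `b`.
m/b-k/a∈[0,1⟩⇔ : ∀ m b k a .{{_ : NonZero a}} .{{_ : NonZero b}} →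
  InUnitInterval (+ m / b ℚ.- + k / a)
    ⇔ (⌈ k ℕ.* b / a ⌉ ≤ m × m < ⌈ k ℕ.* b / a ⌉ ℕ.+ b)
m/b-k/a∈[0,1⟩⇔ m b k a = mk⇔
  (λ (0≤δ , δ<1) →
    Equivalence.from ceiling
      (Equivalence.to (/-≤-/ k a m b)
        (subst (ℚ._≤ + m / b) (ℚP.+-identityˡ _) (Equivalence.to (p≤q-r⇔p+r≤q 0ℚ _ _) 0≤δ))) ,
    ℕP.≰⇒> (λ c+b≤m → ℚP.<-irrefl refl (ℚP.<-≤-trans δ<1 (Equivalence.from 1≤δ⇔ c+b≤m))))
  (λ (c≤m , m<c+b) →
    Equivalence.from (p≤q-r⇔p+r≤q 0ℚ _ _)
      (subst (ℚ._≤ + m / b) (sym (ℚP.+-identityˡ _))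
        (Equivalence.from (/-≤-/ k a m b) (Equivalence.to ceiling c≤m))) ,
    ℚP.≰⇒> (λ 1≤δ → ℕP.<⇒≱ m<c+b (Equivalence.to 1≤δ⇔ 1≤δ)))
  where
  δ = + m / b ℚ.- + k / a
  ceiling = ⌈n/a⌉≤m⇔n≤m*a (k ℕ.* b) a m
  shifted : ⌈ (k ℕ.+ a) ℕ.* b / a ⌉ ≡ ⌈ k ℕ.* b / a ⌉ ℕ.+ b
  shifted = trans
    (cong (λ x → ⌈ x / a ⌉) (trans (ℕP.*-distribʳ-+ b k a) (cong (k ℕ.* b ℕ.+_) (ℕP.*-comm a b))))
    (⌈n+m*a/a⌉≡⌈n/a⌉+m (k ℕ.* b) b a)
  1≤δ⇔ : 1ℚ ℚ.≤ δ ⇔ ⌈ k ℕ.* b / a ⌉ ℕ.+ b ≤ m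
  1≤δ⇔ = mk⇔
    (λ 1≤δ → subst (_≤ m) shifted (Equivalence.from ceiling′
      (Equivalence.to (/-≤-/ (k ℕ.+ a) a m b)
        (subst (ℚ._≤ + m / b) (1+k/a≡[k+a]/a k a) (Equivalence.to (p≤q-r⇔p+r≤q 1ℚ _ _) 1≤δ)))))
    (λ c+b≤m → Equivalence.from (p≤q-r⇔p+r≤q 1ℚ _ _)
      (subst (ℚ._≤ + m / b) (sym (1+k/a≡[k+a]/a k a)) (Equivalence.from (/-≤-/ (k ℕ.+ a) a m b)
        (Equivalence.to ceiling′ (subst (_≤ m) (sym shifted) c+b≤m)))))
    where ceiling′ = ⌈n/a⌉≤m⇔n≤m*a ((k ℕ.+ a) ℕ.* b) a m

-- Extending lattice points by a coordinate

partialSum-differences : ∀ (r : Vector ℚ n) j → partialSum (differences r) j ≡ r j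
-- `partialSum` recurses from the front, but telescoping adds a term at the end; hence the induction
-- from `inject₁ j` to `suc j`.
partialSum-differences {suc n} r = <-weakInduction _ refl λ j ih → begin
  partialSum (differences r) (suc j)
    ≡⟨ partialSum-step (differences r) j ⟩
  partialSum (differences r) (inject₁ j) ℚ.+ (r (suc j) ℚ.- r (inject₁ j))
    ≡⟨ cong (ℚ._+ (r (suc j) ℚ.- r (inject₁ j))) ih ⟩
  r (inject₁ j) ℚ.+ (r (suc j) ℚ.- r (inject₁ j))
    ≡⟨ ℚP.+-comm (r (inject₁ j)) _ ⟩
  r (suc j) ℚ.- r (inject₁ j) ℚ.+ r (inject₁ j)
    ≡⟨ p-q+q≡p (r (suc j)) (r (inject₁ j)) ⟩
  r (suc j) ∎
  where open ≡-Reasoning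

-- Coordinate `j` of a combination of the generators is `s j` times a partial sum of the
-- coefficients. So the ratios of coordinates to `s` are the partial sums, their differences are the
-- only possible coefficients, and membership amounts to the bounds on these.
∈Π⇔ : ∀ (pt : Vec ℤ n) s →
  pt ∈Π s ⇔ (∀ i → InUnitInterval (differences (ratio pt s) i))
∈Π⇔ {n} pt s = mk⇔
  (λ pt∈ i → subst InUnitInterval (coefficients-unique pt s pt∈ i) (proj₁ (proj₂ pt∈) i))
  (λ bounds → differences (ratio pt s) , bounds , λ j → sym (trans
    (combination (differences (ratio pt s)) j (+ value (s j)))
    (trans (cong (ℚ._* (+ value (s j) / 1)) (partialSum-differences (ratio pt s) j))
      (/-*-cancel (lookup pt j) (value (s j)) {{ℕ⁺.nonZero (s j)}}))))

lookup-∷ʳ-inject₁ : ∀ (xs : Vec A n) x i → lookup (xs ∷ʳ x) (inject₁ i) ≡ lookup xs i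
lookup-∷ʳ-inject₁ (y ∷ xs) x zero    = refl
lookup-∷ʳ-inject₁ (y ∷ xs) x (suc i) = lookup-∷ʳ-inject₁ xs x i

lookup-∷ʳ-fromℕ : ∀ (xs : Vec A n) x → lookup (xs ∷ʳ x) (fromℕ n) ≡ x
lookup-∷ʳ-fromℕ []       x = refl
lookup-∷ʳ-fromℕ (y ∷ xs) x = lookup-∷ʳ-fromℕ xs x

lookup-fromℕ : ∀ (xs : Vec A (suc n)) → lookup xs (fromℕ n) ≡ last xs
lookup-fromℕ (x ∷ [])     = refl
lookup-fromℕ (x ∷ y ∷ xs) = lookup-fromℕ (y ∷ xs)

-- The denominator carries its own proof of being nonzero, so `cong₂` can rewrite both at once.
infixl 7 _/⁺_
_/⁺_ : ℤ → ℕ⁺ → ℚ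
z /⁺ c = _/_ z (value c) {{ℕ⁺.nonZero c}}

differences-inject₁ : ∀ (r : Vector ℚ (suc n)) →
  differences r ∘ inject₁ ≗ differences (r ∘ inject₁)
differences-inject₁ r zero    = refl
differences-inject₁ r (suc i) = refl

module _ (s : ℕ → ℕ⁺) (pt : Vec ℤ (suc m)) (z : ℤ) where

  private
    t  = prefix s (suc m)
    t⁺ = prefix s (suc (suc m))
    r  = ratio pt t
    r⁺ = ratio (pt ∷ʳ z) t⁺
    lastDifference = z /⁺ s (suc (suc m)) ℚ.- last pt /⁺ s (suc m)

    r⁺-inject₁ : r⁺ ∘ inject₁ ≗ r
    r⁺-inject₁ j = cong₂ (λ x i → x /⁺ s (suc i)) (lookup-∷ʳ-inject₁ pt z j) (toℕ-inject₁ j)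

    differences-r⁺-inject₁ : ∀ i → differences r⁺ (inject₁ i) ≡ differences r i
    differences-r⁺-inject₁ i = trans (differences-inject₁ r⁺ i) (differences-cong r⁺-inject₁ i)

    differences-r⁺-fromℕ : differences r⁺ (fromℕ (suc m)) ≡ lastDifference
    differences-r⁺-fromℕ = cong₂ ℚ._-_
      (cong₂ (λ x i → x /⁺ s (suc i)) (lookup-∷ʳ-fromℕ pt z) (cong suc (toℕ-fromℕ m)))
      (trans (r⁺-inject₁ (fromℕ m))
        (cong₂ (λ x i → x /⁺ s (suc i)) (lookup-fromℕ pt) (toℕ-fromℕ m)))

  -- A difference of ratios involves only a coordinate and its predecessor. Appending `z` therefore
  -- keeps all earlier coefficients and creates a single new one.
  ∷ʳ-∈Π⇔ : (pt ∷ʳ z) ∈Π t⁺ ⇔ (pt ∈Π t × InUnitInterval lastDifference)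
  ∷ʳ-∈Π⇔ = mk⇔
    (λ ∈Π⁺ → let bounds = Equivalence.to (∈Π⇔ (pt ∷ʳ z) t⁺) ∈Π⁺ in
      Equivalence.from (∈Π⇔ pt t)
        (λ i → subst InUnitInterval (differences-r⁺-inject₁ i) (bounds (inject₁ i))) ,
      subst InUnitInterval differences-r⁺-fromℕ (bounds (fromℕ (suc m))))
    (λ (pt∈ , δ∈) → Equivalence.from (∈Π⇔ (pt ∷ʳ z) t⁺)
      (allBounds (Equivalence.to (∈Π⇔ pt t) pt∈) δ∈))
    where
    allBounds : (∀ i → InUnitInterval (differences r i)) → InUnitInterval lastDifference →
      ∀ i → InUnitInterval (differences r⁺ i)
    allBounds bounds δ∈ i with view i
    ... | ‵fromℕ     = subst InUnitInterval (sym differences-r⁺-fromℕ) δ∈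
    ... | ‵inject₁ j = subst InUnitInterval (sym (differences-r⁺-inject₁ j)) (bounds j)

module _ (s : ℕ → ℕ⁺) (m : ℕ) where

  private
    a⁺ = s (suc m)
    b⁺ = s (suc (suc m))
    b  = value b⁺

  -- The function f of the opening idea, for n = m + 2.
  firstHeight : ℕ → ℕ
  firstHeight k = ⌈_/_⌉ (k ℕ.* b) (value a⁺) {{ℕ⁺.nonZero a⁺}}

  extend : Vec ℤ (suc m) → ℕ → Vec ℤ (suc (suc m))
  extend pt j = pt ∷ʳ + (firstHeight ∣ last pt ∣ ℕ.+ j)

  extend-injective : ∀ {pt pt′ j j′} → extend pt j ≡ extend pt′ j′ → pt ≡ pt′ × j ≡ j′
  extend-injective {pt} {pt′} eq with refl , eq′ ← ∷ʳ-injective pt pt′ eq =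
    refl , ℕP.+-cancelˡ-≡ (firstHeight ∣ last pt ∣) _ _ (ℤP.+-injective eq′)

  private
    t  = prefix s (suc m)
    t⁺ = prefix s (suc (suc m))
    L  = latticePoints t
    L⁺ = latticePoints t⁺

    L→Π : ∀ pt → pt ∈ L → pt ∈Π t
    L→Π pt = Equivalence.to (∈-latticePoints t pt)

    L⁺→Π : ∀ pt⁺ → pt⁺ ∈ L⁺ → pt⁺ ∈Π t⁺
    L⁺→Π pt⁺ = Equivalence.to (∈-latticePoints t⁺ pt⁺)

    lastCoord-nonNeg : ∀ pt → pt ∈ L → + ∣ last pt ∣ ≡ last pt
    lastCoord-nonNeg pt pt∈L = ℤP.0≤i⇒+∣i∣≡i
      (subst (0ℤ ℤ.≤_) (lookup-fromℕ pt) (latticePoints-nonNeg t pt pt∈L (fromℕ m)))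

    -- The fibre over `pt`: membership of `pt` settles all coefficients but the last, whose bounds
    -- are an interval of `b` consecutive heights.
    heights : ∀ pt → pt ∈ L → ∀ h → (pt ∷ʳ + h) ∈ L⁺
      ⇔ (firstHeight ∣ last pt ∣ ≤ h × h < firstHeight ∣ last pt ∣ ℕ.+ b)
    heights pt pt∈L h = mk⇔
      -- `interval` speaks of natural numerators, so the last coordinate of `pt` is traded for its
      -- absolute value.
      (λ ∈L⁺ → Equivalence.to interval (subst (λ k → InUnitInterval (+ h /⁺ b⁺ ℚ.- k /⁺ a⁺))
        (sym (lastCoord-nonNeg pt pt∈L))
        (proj₂ (Equivalence.to (∷ʳ-∈Π⇔ s pt (+ h)) (L⁺→Π (pt ∷ʳ + h) ∈L⁺)))))
      (λ hs → Equivalence.from (∈-latticePoints t⁺ (pt ∷ʳ + h))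
        (Equivalence.from (∷ʳ-∈Π⇔ s pt (+ h))
          (L→Π pt pt∈L ,
           subst (λ k → InUnitInterval (+ h /⁺ b⁺ ℚ.- k /⁺ a⁺)) (lastCoord-nonNeg pt pt∈L)
             (Equivalence.from interval hs))))
      where interval = m/b-k/a∈[0,1⟩⇔ h b ∣ last pt ∣ (value a⁺)
                         {{ℕ⁺.nonZero a⁺}} {{ℕ⁺.nonZero b⁺}}

    ∷ʳ-⊆ : ∀ pt z → 0ℤ ℤ.≤ z → pt ∷ʳ z ∈ L⁺ → pt ∷ʳ z ∈ cartesianProductWith extend L (upTo b)
    ∷ʳ-⊆ pt (+ h) _ ∈L⁺ =
      -- The second component of the preimage under `extend` is `h ∸ c`, the offset above the lowest
      -- height.
      subst (λ x → pt ∷ʳ + x ∈ cartesianProductWith extend L (upTo b)) (ℕP.m+[n∸m]≡n c≤h)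
        (∈-cartesianProductWith⁺ extend pt∈L (∈-upTo⁺ h∸c<b))
      where
      c = firstHeight ∣ last pt ∣
      pt∈L : pt ∈ L
      pt∈L = Equivalence.from (∈-latticePoints t pt)
        (proj₁ (Equivalence.to (∷ʳ-∈Π⇔ s pt (+ h)) (L⁺→Π (pt ∷ʳ + h) ∈L⁺)))
      c≤h : c ≤ h
      c≤h = proj₁ (Equivalence.to (heights pt pt∈L h) ∈L⁺)
      h∸c<b : h ∸ c < b
      h∸c<b = subst (h ∸ c <_) (ℕP.m+n∸m≡n c b)
        (ℕP.∸-monoˡ-< (proj₂ (Equivalence.to (heights pt pt∈L h) ∈L⁺)) c≤h)

    L⁺⊆ : ∀ pt⁺ → pt⁺ ∈ L⁺ → pt⁺ ∈ cartesianProductWith extend L (upTo b)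
    L⁺⊆ pt⁺ ∈L⁺ =
      let pt , z , pt⁺≡ = initLast pt⁺
          pt∷ʳz∈L⁺ = subst (_∈ L⁺) pt⁺≡ ∈L⁺
          0≤z = subst (0ℤ ℤ.≤_) (lookup-∷ʳ-fromℕ pt z)
                  (latticePoints-nonNeg t⁺ (pt ∷ʳ z) pt∷ʳz∈L⁺ (fromℕ (suc m)))
      in subst (_∈ cartesianProductWith extend L (upTo b)) (sym pt⁺≡) (∷ʳ-⊆ pt z 0≤z pt∷ʳz∈L⁺)

    ⊆L⁺ : ∀ pt⁺ → pt⁺ ∈ cartesianProductWith extend L (upTo b) → pt⁺ ∈ L⁺
    ⊆L⁺ pt⁺ ∈× =
      let pt , j , pt∈L , j∈ , pt⁺≡ = ∈-cartesianProductWith⁻ extend L (upTo b) ∈×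
      in subst (_∈ L⁺) (sym pt⁺≡) (Equivalence.from (heights pt pt∈L _)
           (ℕP.m≤m+n (firstHeight ∣ last pt ∣) j ,
            ℕP.+-monoʳ-< (firstHeight ∣ last pt ∣) (∈-upTo⁻ j∈)))

  -- Both lists are free of duplicates and have the same members, so they agree up to order; the two
  -- enumerations need not be compared term by term.
  latticePoints-↭ : L⁺ ↭ cartesianProductWith extend L (upTo b)
  latticePoints-↭ = ∼bag⇒↭ (unique∧set⇒bag
    (latticePoints-unique t⁺)
    (Unique.cartesianProductWith⁺ extend extend-injective (latticePoints-unique t) (Unique.upTo⁺ b))
    (λ {pt⁺} → mk⇔ (L⁺⊆ pt⁺) (⊆L⁺ pt⁺)))

-- Sums of monomials

coeff-+ₚ : ∀ p q k → coeff (p +ₚ q) k ≡ coeff p k ℤ.+ coeff q k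
coeff-+ₚ []      q       k       = sym (ℤP.+-identityˡ _)
coeff-+ₚ (a ∷ p) []      k       = sym (ℤP.+-identityʳ _)
coeff-+ₚ (a ∷ p) (b ∷ q) zero    = refl
coeff-+ₚ (a ∷ p) (b ∷ q) (suc k) = coeff-+ₚ p q k

coeff-scale : ∀ a p k → coeff (map (a ℤ.*_) p) k ≡ a ℤ.* coeff p k
coeff-scale a []      k       = sym (ℤP.*-zeroʳ a)
coeff-scale a (b ∷ p) zero    = refl
coeff-scale a (b ∷ p) (suc k) = coeff-scale a p k

+ₚ-cong : ∀ p p′ q q′ → p ≈ₚ p′ → q ≈ₚ q′ → p +ₚ q ≈ₚ p′ +ₚ q′
+ₚ-cong p p′ q q′ p≈ q≈ k = begin
  coeff (p +ₚ q) k              ≡⟨ coeff-+ₚ p q k ⟩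
  coeff p k ℤ.+ coeff q k       ≡⟨ cong₂ ℤ._+_ (p≈ k) (q≈ k) ⟩
  coeff p′ k ℤ.+ coeff q′ k     ≡⟨ coeff-+ₚ p′ q′ k ⟨
  coeff (p′ +ₚ q′) k            ∎
  where open ≡-Reasoning

0∷-cong : ∀ p q → p ≈ₚ q → 0ℤ ∷ p ≈ₚ 0ℤ ∷ q
0∷-cong p q p≈q zero    = refl
0∷-cong p q p≈q (suc k) = p≈q k

coeff-∷-*ₚ : ∀ a p q k → coeff ((a ∷ p) *ₚ q) k ≡ a ℤ.* coeff q k ℤ.+ coeff (0ℤ ∷ p *ₚ q) k
coeff-∷-*ₚ a p q k = trans (coeff-+ₚ (map (a ℤ.*_) q) _ k)
  (cong (ℤ._+ coeff (0ℤ ∷ p *ₚ q) k) (coeff-scale a q k))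

*ₚ-distribʳ-+ₚ : ∀ r p q → (p +ₚ q) *ₚ r ≈ₚ p *ₚ r +ₚ q *ₚ r
*ₚ-distribʳ-+ₚ r []      q       k = refl
*ₚ-distribʳ-+ₚ r (a ∷ p) []      k = sym (trans (coeff-+ₚ ((a ∷ p) *ₚ r) [] k) (ℤP.+-identityʳ _))
*ₚ-distribʳ-+ₚ r (a ∷ p) (b ∷ q) k = begin
  coeff ((a ℤ.+ b ∷ p +ₚ q) *ₚ r) k
    ≡⟨ coeff-∷-*ₚ (a ℤ.+ b) (p +ₚ q) r k ⟩
  (a ℤ.+ b) ℤ.* coeff r k ℤ.+ coeff (0ℤ ∷ (p +ₚ q) *ₚ r) k
    ≡⟨ cong₂ ℤ._+_ (ℤP.*-distribʳ-+ (coeff r k) a b)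
         (trans (0∷-cong ((p +ₚ q) *ₚ r) (p *ₚ r +ₚ q *ₚ r) (*ₚ-distribʳ-+ₚ r p q) k)
           (coeff-+ₚ (0ℤ ∷ p *ₚ r) (0ℤ ∷ q *ₚ r) k)) ⟩
  (a ℤ.* coeff r k ℤ.+ b ℤ.* coeff r k) ℤ.+ (coeff (0ℤ ∷ p *ₚ r) k ℤ.+ coeff (0ℤ ∷ q *ₚ r) k)
    ≡⟨ medial (a ℤ.* coeff r k) _ _ _ ⟩
  (a ℤ.* coeff r k ℤ.+ coeff (0ℤ ∷ p *ₚ r) k) ℤ.+ (b ℤ.* coeff r k ℤ.+ coeff (0ℤ ∷ q *ₚ r) k)
    ≡⟨ cong₂ ℤ._+_ (coeff-∷-*ₚ a p r k) (coeff-∷-*ₚ b q r k) ⟨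
  coeff ((a ∷ p) *ₚ r) k ℤ.+ coeff ((b ∷ q) *ₚ r) k
    ≡⟨ coeff-+ₚ ((a ∷ p) *ₚ r) ((b ∷ q) *ₚ r) k ⟨
  coeff ((a ∷ p) *ₚ r +ₚ (b ∷ q) *ₚ r) k ∎
  where
  open ≡-Reasoning
  open import Algebra.Properties.CommutativeSemigroup ℤP.+-commutativeSemigroup
    renaming (interchange to medial)

-- A polynomial given by its exponents with multiplicity. Reordering the list preserves it up to
-- `≈ₚ`, and multiplication becomes pairwise addition of exponents.
Σx^ : List ℕ → Poly
Σx^ ks = Σₚ (map x^ ks)

Σx^-++ : ∀ ks ls → Σx^ (ks ++ ls) ≈ₚ Σx^ ks +ₚ Σx^ ls
Σx^-++ []       ls i = refl
Σx^-++ (k ∷ ks) ls i = begin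
  coeff (x^ k +ₚ Σx^ (ks ++ ls)) i                           ≡⟨ coeff-+ₚ (x^ k) _ i ⟩
  coeff (x^ k) i ℤ.+ coeff (Σx^ (ks ++ ls)) i
    ≡⟨ cong (λ c → coeff (x^ k) i ℤ.+ c) (trans (Σx^-++ ks ls i) (coeff-+ₚ (Σx^ ks) _ i)) ⟩
  coeff (x^ k) i ℤ.+ (coeff (Σx^ ks) i ℤ.+ coeff (Σx^ ls) i) ≡⟨ ℤP.+-assoc (coeff (x^ k) i) _ _ ⟨
  coeff (x^ k) i ℤ.+ coeff (Σx^ ks) i ℤ.+ coeff (Σx^ ls) i
    ≡⟨ cong (ℤ._+ coeff (Σx^ ls) i) (coeff-+ₚ (x^ k) (Σx^ ks) i) ⟨
  coeff (Σx^ (k ∷ ks)) i ℤ.+ coeff (Σx^ ls) i                ≡⟨ coeff-+ₚ (Σx^ (k ∷ ks)) (Σx^ ls) i ⟨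
  coeff (Σx^ (k ∷ ks) +ₚ Σx^ ls) i                           ∎
  where open ≡-Reasoning

Σx^-↭ : ∀ {ks ls} → ks ↭ ls → Σx^ ks ≈ₚ Σx^ ls
Σx^-↭ Perm.refl i = refl
Σx^-↭ {_ ∷ ks} {_ ∷ ls} (Perm.prep k p) =
  +ₚ-cong (x^ k) (x^ k) (Σx^ ks) (Σx^ ls) (λ _ → refl) (Σx^-↭ p)
Σx^-↭ {_ ∷ _ ∷ ks} {_ ∷ _ ∷ ls} (Perm.swap k l p) i = begin
  coeff (x^ k +ₚ (x^ l +ₚ Σx^ ks)) i
    ≡⟨ trans (coeff-+ₚ (x^ k) _ i) (cong (λ c → coeff (x^ k) i ℤ.+ c) (coeff-+ₚ (x^ l) _ i)) ⟩
  coeff (x^ k) i ℤ.+ (coeff (x^ l) i ℤ.+ coeff (Σx^ ks) i)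
    ≡⟨ x∙yz≈y∙xz (coeff (x^ k) i) (coeff (x^ l) i) (coeff (Σx^ ks) i) ⟩
  coeff (x^ l) i ℤ.+ (coeff (x^ k) i ℤ.+ coeff (Σx^ ks) i)
    ≡⟨ cong (λ c → coeff (x^ l) i ℤ.+ (coeff (x^ k) i ℤ.+ c)) (Σx^-↭ p i) ⟩
  coeff (x^ l) i ℤ.+ (coeff (x^ k) i ℤ.+ coeff (Σx^ ls) i)
    ≡⟨ trans (coeff-+ₚ (x^ l) _ i) (cong (λ c → coeff (x^ l) i ℤ.+ c) (coeff-+ₚ (x^ k) _ i)) ⟨
  coeff (x^ l +ₚ (x^ k +ₚ Σx^ ls)) i ∎
  where
  open ≡-Reasoning
  open import Algebra.Properties.CommutativeSemigroup ℤP.+-commutativeSemigroup using (x∙yz≈y∙xz)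
Σx^-↭ (Perm.trans p q) i = trans (Σx^-↭ p i) (Σx^-↭ q i)

Σx^-map-suc : ∀ ks → Σx^ (map suc ks) ≈ₚ 0ℤ ∷ Σx^ ks
Σx^-map-suc []       zero    = refl
Σx^-map-suc []       (suc i) = refl
Σx^-map-suc (k ∷ ks) =
  +ₚ-cong (0ℤ ∷ x^ k) (0ℤ ∷ x^ k) (Σx^ (map suc ks)) (0ℤ ∷ Σx^ ks) (λ _ → refl) (Σx^-map-suc ks)

x^-*ₚ-Σx^ : ∀ k ls → x^ k *ₚ Σx^ ls ≈ₚ Σx^ (map (k ℕ.+_) ls)
x^-*ₚ-Σx^ zero ls i = begin
  coeff (x^ 0 *ₚ Σx^ ls) i                         ≡⟨ coeff-∷-*ₚ 1ℤ [] (Σx^ ls) i ⟩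
  1ℤ ℤ.* coeff (Σx^ ls) i ℤ.+ coeff (0ℤ ∷ []) i
    ≡⟨ cong₂ ℤ._+_ (ℤP.*-identityˡ (coeff (Σx^ ls) i)) (coeff-0∷[] i) ⟩
  coeff (Σx^ ls) i ℤ.+ 0ℤ                          ≡⟨ ℤP.+-identityʳ _ ⟩
  coeff (Σx^ ls) i                                 ≡⟨ cong (λ l → coeff (Σx^ l) i) (map-id ls) ⟨
  coeff (Σx^ (map (0 ℕ.+_) ls)) i                  ∎
  where
  open ≡-Reasoning
  coeff-0∷[] : ∀ i → coeff (0ℤ ∷ []) i ≡ 0ℤ
  coeff-0∷[] zero    = refl
  coeff-0∷[] (suc i) = refl
x^-*ₚ-Σx^ (suc k) ls i = begin
  coeff (x^ (suc k) *ₚ Σx^ ls) i                   ≡⟨ coeff-∷-*ₚ 0ℤ (x^ k) (Σx^ ls) i ⟩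
  0ℤ ℤ.+ coeff (0ℤ ∷ x^ k *ₚ Σx^ ls) i             ≡⟨ ℤP.+-identityˡ _ ⟩
  coeff (0ℤ ∷ x^ k *ₚ Σx^ ls) i
    ≡⟨ 0∷-cong (x^ k *ₚ Σx^ ls) (Σx^ (map (k ℕ.+_) ls)) (x^-*ₚ-Σx^ k ls) i ⟩
  coeff (0ℤ ∷ Σx^ (map (k ℕ.+_) ls)) i             ≡⟨ Σx^-map-suc (map (k ℕ.+_) ls) i ⟨
  coeff (Σx^ (map suc (map (k ℕ.+_) ls))) i        ≡⟨ cong (λ l → coeff (Σx^ l) i) (map-∘ ls) ⟨
  coeff (Σx^ (map (suc k ℕ.+_) ls)) i              ∎
  where open ≡-Reasoning

Σx^-*ₚ : ∀ ks ls → Σx^ ks *ₚ Σx^ ls ≈ₚ Σx^ (cartesianProductWith ℕ._+_ ks ls)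
Σx^-*ₚ []       ls i = refl
Σx^-*ₚ (k ∷ ks) ls i = begin
  coeff ((x^ k +ₚ Σx^ ks) *ₚ Σx^ ls) i
    ≡⟨ *ₚ-distribʳ-+ₚ (Σx^ ls) (x^ k) (Σx^ ks) i ⟩
  coeff (x^ k *ₚ Σx^ ls +ₚ Σx^ ks *ₚ Σx^ ls) i
    ≡⟨ +ₚ-cong (x^ k *ₚ Σx^ ls) (Σx^ (map (k ℕ.+_) ls)) (Σx^ ks *ₚ Σx^ ls)
         (Σx^ (cartesianProductWith ℕ._+_ ks ls))
         (x^-*ₚ-Σx^ k ls) (Σx^-*ₚ ks ls) i ⟩
  coeff (Σx^ (map (k ℕ.+_) ls) +ₚ Σx^ (cartesianProductWith ℕ._+_ ks ls)) i
    ≡⟨ Σx^-++ (map (k ℕ.+_) ls) _ i ⟨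
  coeff (Σx^ (cartesianProductWith ℕ._+_ (k ∷ ks) ls)) i ∎
  where open ≡-Reasoning

-- Spreading a polynomial by a strictly increasing function

StrictlyIncreasing : (ℕ → ℕ) → Set
StrictlyIncreasing f = ∀ {i j} → i < j → f i < f j

-- Target positions of the remaining coefficients, counted from just after position `f 0`. For
-- strictly increasing `f` the subtraction never truncates.
rest : (ℕ → ℕ) → ℕ → ℕ
rest f k = f (suc k) ∸ suc (f 0)

zeros : ℕ → Poly → Poly
zeros k p = replicate k 0ℤ ++ p

-- Σ pₖ x^k ↦ Σ pₖ x^f(k), for strictly increasing f.
spread : (ℕ → ℕ) → Poly → Poly
spread f []      = []
spread f (a ∷ p) = zeros (f 0) (a ∷ spread (rest f) p)

nonzeroCoeffs-zeros : ∀ k p → nonzeroCoeffs (zeros k p) ≡ nonzeroCoeffs p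
nonzeroCoeffs-zeros zero    p = refl
nonzeroCoeffs-zeros (suc k) p = nonzeroCoeffs-zeros k p

nonzeroCoeffs-∷ : ∀ a {p q} → nonzeroCoeffs p ≡ nonzeroCoeffs q →
  nonzeroCoeffs (a ∷ p) ≡ nonzeroCoeffs (a ∷ q)
nonzeroCoeffs-∷ a eq with a ℤP.≟ 0ℤ
... | yes _ = eq
... | no  _ = cong (a ∷_) eq

-- Each coefficient is kept, in order, and only zeros are put in front of it; the filter discards
-- those.
nonzeroCoeffs-spread : ∀ f p → nonzeroCoeffs (spread f p) ≡ nonzeroCoeffs p
nonzeroCoeffs-spread f []      = refl
nonzeroCoeffs-spread f (a ∷ p) = trans
  (nonzeroCoeffs-zeros (f 0) _)
  (nonzeroCoeffs-∷ a (nonzeroCoeffs-spread (rest f) p))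

+ₚ-identityʳ : ∀ p → p +ₚ [] ≡ p
+ₚ-identityʳ []      = refl
+ₚ-identityʳ (a ∷ p) = refl

zeros-+ₚ : ∀ k p q → zeros k p +ₚ zeros k q ≡ zeros k (p +ₚ q)
zeros-+ₚ zero    p q = refl
zeros-+ₚ (suc k) p q = cong (0ℤ ∷_) (zeros-+ₚ k p q)

-- Both summands receive the same padding, so corresponding coefficients stay aligned. This reduces
-- spreading a sum to spreading monomials.
spread-+ₚ : ∀ f p q → spread f (p +ₚ q) ≡ spread f p +ₚ spread f q
spread-+ₚ f []      q       = refl
spread-+ₚ f (a ∷ p) []      = sym (+ₚ-identityʳ _)
spread-+ₚ f (a ∷ p) (b ∷ q) = trans
  (cong (λ r → zeros (f 0) (a ℤ.+ b ∷ r)) (spread-+ₚ (rest f) p q))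
  (sym (zeros-+ₚ (f 0) _ _))

zeros-x^ : ∀ m k → zeros m (x^ k) ≡ x^ (m ℕ.+ k)
zeros-x^ zero    k = refl
zeros-x^ (suc m) k = cong (0ℤ ∷_) (zeros-x^ m k)

rest-increasing : ∀ {f} → StrictlyIncreasing f → StrictlyIncreasing (rest f)
rest-increasing f↑ i<j = ℕP.∸-monoˡ-< (f↑ (s≤s i<j)) (f↑ (s≤s z≤n))

spread-x^ : ∀ {f} → StrictlyIncreasing f → ∀ k → spread f (x^ k) ≡ x^ (f k)
spread-x^ {f} f↑ zero    = trans (zeros-x^ (f 0) 0) (cong x^ (ℕP.+-identityʳ (f 0)))
spread-x^ {f} f↑ (suc k) = begin
  zeros (f 0) (0ℤ ∷ spread (rest f) (x^ k))
    ≡⟨ cong (λ p → zeros (f 0) (0ℤ ∷ p)) (spread-x^ (rest-increasing f↑) k) ⟩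
  zeros (f 0) (x^ (suc (rest f k)))           ≡⟨ zeros-x^ (f 0) (suc (rest f k)) ⟩
  x^ (f 0 ℕ.+ suc (rest f k))
    -- Strict monotonicity gives `suc (f 0) ≤ f (suc k)`, so adding back what `rest` subtracted is
    -- exact.
    ≡⟨ cong x^ (trans (ℕP.+-suc (f 0) _) (ℕP.m+[n∸m]≡n (f↑ (s≤s z≤n)))) ⟩
  x^ (f (suc k))                              ∎
  where open ≡-Reasoning

spread-Σx^ : ∀ {f} → StrictlyIncreasing f → ∀ ks → spread f (Σx^ ks) ≡ Σx^ (map f ks)
spread-Σx^ f↑ []       = refl
spread-Σx^ f↑ (k ∷ ks) = trans (spread-+ₚ _ (x^ k) (Σx^ ks))
  (cong₂ _+ₚ_ (spread-x^ f↑ k) (spread-Σx^ f↑ ks))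

-- Reindexing Cartesian products of lists

map-cartesianProductWith : ∀ (h : C → D) (f : A → B → C) xs ys →
  map h (cartesianProductWith f xs ys) ≡ cartesianProductWith (λ x y → h (f x y)) xs ys
map-cartesianProductWith h f []       ys = refl
map-cartesianProductWith h f (x ∷ xs) ys = trans
  (map-++ h (map (f x) ys) _)
  (cong₂ _++_ (sym (map-∘ ys)) (map-cartesianProductWith h f xs ys))

cartesianProductWith-mapˡ : ∀ (f : B → C → D) (g : A → B) xs ys →
  cartesianProductWith f (map g xs) ys ≡ cartesianProductWith (λ x → f (g x)) xs ys
cartesianProductWith-mapˡ f g []       ys = refl
cartesianProductWith-mapˡ f g (x ∷ xs) ys =
  cong (map (f (g x)) ys ++_) (cartesianProductWith-mapˡ f g xs ys)

cartesianProductWith-cong : ∀ {f g : A → B → C} → (∀ x y → f x y ≡ g x y) →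
  ∀ xs ys → cartesianProductWith f xs ys ≡ cartesianProductWith g xs ys
cartesianProductWith-cong eq []       ys = refl
cartesianProductWith-cong eq (x ∷ xs) ys =
  cong₂ _++_ (map-cong (eq x) ys) (cartesianProductWith-cong eq xs ys)

-- Last coordinates of lattice points and the quotient polynomial

heightsOfΠ : (ℕ → ℕ⁺) → ℕ → List ℕ
heightsOfΠ s n = map (∣_∣ ∘ lastCoord) (latticePoints (prefix s n))

Q≡Σx^ : ∀ s n → Q s n ≡ Σx^ (heightsOfΠ s n)
Q≡Σx^ s n = cong Σₚ (map-∘ (latticePoints (prefix s n)))

-- The last coordinate of `extend s m pt j` is the lowest height over `pt` plus `j`, and the lowest
-- height depends on `pt` only through its last coordinate. So the exponents form a product of two
-- lists.
heightsOfΠ-↭ : ∀ s m → heightsOfΠ s (suc (suc m))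
  ↭ cartesianProductWith ℕ._+_ (map (firstHeight s m) (heightsOfΠ s (suc m)))
      (upTo (value (s (suc (suc m)))))
heightsOfΠ-↭ s m =
  Perm.trans (map⁺ (∣_∣ ∘ lastCoord) (latticePoints-↭ s m)) (Perm.↭-reflexive (begin
  map (∣_∣ ∘ lastCoord) (cartesianProductWith (extend s m) L js)
    ≡⟨ map-cartesianProductWith (∣_∣ ∘ lastCoord) (extend s m) L js ⟩
  cartesianProductWith (λ pt j → ∣ last (extend s m pt j) ∣) L js
    ≡⟨ cartesianProductWith-cong (λ pt j → cong ∣_∣ (last-∷ʳ _ pt)) L js ⟩
  cartesianProductWith (λ pt → firstHeight s m ∣ lastCoord pt ∣ ℕ.+_) L js
    ≡⟨ cartesianProductWith-mapˡ ℕ._+_ (λ pt → firstHeight s m ∣ lastCoord pt ∣) L js ⟨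
  cartesianProductWith ℕ._+_ (map (λ pt → firstHeight s m ∣ lastCoord pt ∣) L) js
    ≡⟨ cong (λ ks → cartesianProductWith ℕ._+_ ks js) (map-∘ L) ⟩
  cartesianProductWith ℕ._+_ (map (firstHeight s m) (heightsOfΠ s (suc m))) js ∎))
  where
  open ≡-Reasoning
  L  = latticePoints (prefix s (suc m))
  js = upTo (value (s (suc (suc m))))

spread-isQuotient : ∀ s m → StrictlyIncreasing (firstHeight s m) →
  IsQuotient s (suc (suc m)) (spread (firstHeight s m) (Q s (suc m)))
spread-isQuotient s m f↑ i = begin
  -- The divisor `geometric` is `Σx^ js` by definition.
  coeff (spread f (Q s (suc m)) *ₚ Σx^ js) i
    ≡⟨ cong (λ p → coeff (p *ₚ Σx^ js) i)
         (trans (cong (spread f) (Q≡Σx^ s (suc m))) (spread-Σx^ f↑ ks)) ⟩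
  coeff (Σx^ (map f ks) *ₚ Σx^ js) i
    ≡⟨ Σx^-*ₚ (map f ks) js i ⟩
  coeff (Σx^ (cartesianProductWith ℕ._+_ (map f ks) js)) i
    ≡⟨ Σx^-↭ (heightsOfΠ-↭ s m) i ⟨
  coeff (Σx^ (heightsOfΠ s (suc (suc m)))) i
    ≡⟨ cong (λ p → coeff p i) (Q≡Σx^ s (suc (suc m))) ⟨
  coeff (Q s (suc (suc m))) i ∎
  where
  open ≡-Reasoning
  f  = firstHeight s m
  ks = heightsOfΠ s (suc m)
  js = upTo (value (s (suc (suc m))))

contractibleAt : ∀ s m → value (s (suc m)) ≤ value (s (suc (suc m))) →
  ContractibleAt s (suc (suc m))
contractibleAt s m a≤b =
  spread (firstHeight s m) (Q s (suc m)) ,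
  spread-isQuotient s m (⌈k*b/a⌉-mono-< {{ℕ⁺.nonZero (s (suc m))}} a≤b) ,
  sym (nonzeroCoeffs-spread (firstHeight s m) (Q s (suc m)))

proposition5p4 : ∀ (s : ℕ → ℕ⁺) →
    (∀ n → 3 ≤ n → value (s (n ∸ 1)) ≤ value (s n) → ContractibleAt s n)
    × (NondecreasingFrom 2 s → Contractible s)
    × (NondecreasingFrom 1 s → Contractible s)
-- `ℕP.<⇒≤` reads `2 ≤ i` as `1 < i` and weakens it to `1 ≤ i`.
proposition5p4 s = at , from2 , λ mono → from2 λ i j 2≤i → mono i j (ℕP.<⇒≤ 2≤i)
  where
  at : ∀ n → 3 ≤ n → value (s (n ∸ 1)) ≤ value (s n) → ContractibleAt s n
  at (suc (suc m)) _ = contractibleAt s m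
  at (suc zero) (s≤s ())
  from2 : NondecreasingFrom 2 s → Contractible s
  -- Since `n ≥ 3`, the smaller index `n ∸ 1` is at least 2, within the range of `mono`.
  from2 mono n 3≤n = at n 3≤n (mono (n ∸ 1) n (ℕP.∸-monoˡ-≤ 1 3≤n) (ℕP.m∸n≤m n 1))
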